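{- Let $\mathcal V$ be a category with finite products, and let $(H:\mathcal C\to\mathcal D,\ \theta:F'\Rightarrow HF)$ be a morphism of models of SEC from $F:\mathcal V\to\mathcal C$ to $F':\mathcal V\to\mathcal D$. Equip the gluing category $\mathcal D\downarrow H$ with its $\mathcal V$-action. Then the assignments $$Lv:=(F'v,\ Fv,\ \theta_v:F'v\to HFv),\qquad L(a:v\to u):=(F'a,Fa):\theta_v\to\theta_u$$ define a model of SEC, i.e. a strong $\mathcal V$-equivariant functor $L:\mathcal V\to(\mathcal D\downarrow H)$.
   Context: Let $(\mathcal M,\otimes,I)$ be a monoidal category. An $\mathcal M$-action on a category $\mathcal C$ is a bifunctor $(-)\cdot(-):\mathcal M\times\mathcal C\to\mathcal C$ with natural isomorphisms $\eta_c:I\cdot c\to c$ and $\mu_{m_1,m_2,c}:(m_1\otimes m_2)\cdot c\to m_1\cdot(m_2\cdot c)$ such that (suppressing associators) $\mu_{m_1,m_2,m_3\cdot c}\circ\mu_{m_1\otimes m_2,m_3,c}=(\mathrm{id}\cdot\mu_{m_2,m_3,c})\circ\mu_{m_1,m_2\otimes m_3,c}$ and $(\mathrm{id}_m\cdot\eta_c)\circ\mu_{m,I,c}=r_m\cdot\mathrm{id}_c$, with $r_m:m\otimes I\to m$ the right unitor. An $\mathcal M$-actegory is a category with an $\mathcal M$-action; $\mathcal M$ acts on itself by $\otimes$. A functor $F:\mathcal C\to\mathcal D$ between $\mathcal M$-actegories is lax $\mathcal M$-equivariant if it is equipped with a natural transformation $\phi^F_{m,c}:m\cdot Fc\to F(m\cdot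 c)$ such that $F\mu_{m,m',c}\circ\phi^F_{m\otimes m',c}=\phi^F_{m,m'\cdot c}\circ(\mathrm{id}\cdot\phi^F_{m',c})\circ\mu_{m,m',Fc}$ and $F\eta_c\circ\phi^F_{I,c}=\eta_{Fc}$; it is strong if $\phi^F$ is an isomorphism. A natural transformation $\theta:F\Rightarrow G$ between lax equivariant functors is equivariant if $\theta_{m\cdot c}\circ\phi^F_{m,c}=\phi^G_{m,c}\circ(m\cdot\theta_c)$ for all $m,c$. Composites of lax equivariant functors are lax equivariant with $\phi^{HF}=H\phi^F\circ\phi^H$. A model of SEC is a strong $\mathcal V$-equivariant functor $F:\mathcal V\to\mathcal C$, where $\mathcal V$ has finite products and $\mathcal C$ is a $\mathcal V$-actegory for the cartesian monoidal structure of $\mathcal V$. A morphism of models from $F:\mathcal V\to\mathcal C$ to $F':\mathcal V\to\mathcal D$ is a lax $\mathcal V$-equivariant functor $H:\mathcal C\to\mathcal D$ together with an equivariant natural transformation $\theta:F'\Rightarrow HF$. The gluing category $\mathcal D\downarrow H$ is the comma category with objects $(D,C,f:D\to HC)$ and morphisms $(d,c):(D,C,f)\to(D',C',f')$ with $f'\circ d=Hc\circ f$. Its $\mathcal V$-action is $v\cdot(D,C,f)=(v\cdot D,\ v\cdot C,\ \phi^H_{v,C}\circ(v\cdot f))$ and $a\cdot(d,c)=(a\cdot d,a\cdot c)$, with $\eta$ and $\mu$ given componentwise. -}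

module Defs where

open import Level using (Level; _⊔_; suc)
open import Data.Product using (_×_; _,_; proj₁; proj₂)
open import Relation.Binary.Bundles using (Setoid)
open import Relation.Binary.Structures using (IsEquivalence)
import Relation.Binary.Reasoning.Setoid as SetoidReasoning

private
  variable
    o ℓ e o′ ℓ′ e′ o″ ℓ″ e″ : Level

infix 4 _[_≈_] _[_,_]
infix 9 _[_∘_]
infixr 9 _∘F_
infixr 2 _×ᶜ_

-- As usual without quotient types, hom-sets are setoids: equality of
-- morphisms is _≈_.
record Category (o ℓ e : Level) : Set (suc (o ⊔ ℓ ⊔ e)) where
  infix 4 _≈_ _⇒_
  infixr 9 _∘_
  field
    Obj : Set o
    _⇒_ : Obj → Obj → Set ℓ
    _≈_ : ∀ {A B} → A ⇒ B → A ⇒ B → Set e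
    id  : ∀ {A} → A ⇒ A
    _∘_ : ∀ {A B C} → B ⇒ C → A ⇒ B → A ⇒ C

    assoc     : ∀ {A B C D} {f : A ⇒ B} {g : B ⇒ C} {h : C ⇒ D} →
                (h ∘ g) ∘ f ≈ h ∘ (g ∘ f)
    identityˡ : ∀ {A B} {f : A ⇒ B} → id ∘ f ≈ f
    identityʳ : ∀ {A B} {f : A ⇒ B} → f ∘ id ≈ f
    equiv     : ∀ {A B} → IsEquivalence (_≈_ {A} {B})
    ∘-resp-≈  : ∀ {A B C} {f h : B ⇒ C} {g i : A ⇒ B} →
                f ≈ h → g ≈ i → f ∘ g ≈ h ∘ i

  hom-setoid : ∀ {A B} → Setoid ℓ e
  hom-setoid {A} {B} = record { Carrier = A ⇒ B ; _≈_ = _≈_ ; isEquivalence = equiv }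

  module Equiv {A B : Obj} = IsEquivalence (equiv {A} {B})
  module HomReasoning {A B : Obj} = SetoidReasoning (hom-setoid {A} {B})

  ∘-resp-≈ˡ : ∀ {A B C} {f h : B ⇒ C} {g : A ⇒ B} → f ≈ h → f ∘ g ≈ h ∘ g
  ∘-resp-≈ˡ p = ∘-resp-≈ p Equiv.refl

  ∘-resp-≈ʳ : ∀ {A B C} {f : B ⇒ C} {g i : A ⇒ B} → g ≈ i → f ∘ g ≈ f ∘ i
  ∘-resp-≈ʳ p = ∘-resp-≈ Equiv.refl p

  pullˡ : ∀ {A B C D} {f : A ⇒ B} {g : B ⇒ C} {h : C ⇒ D} {k : B ⇒ D} →
          h ∘ g ≈ k → h ∘ (g ∘ f) ≈ k ∘ f
  pullˡ p = Equiv.trans (Equiv.sym assoc) (∘-resp-≈ˡ p)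

  pullʳ : ∀ {A B C D} {f : A ⇒ B} {g : B ⇒ C} {h : C ⇒ D} {k : A ⇒ C} →
          g ∘ f ≈ k → (h ∘ g) ∘ f ≈ h ∘ k
  pullʳ p = Equiv.trans assoc (∘-resp-≈ʳ p)

  extendʳ : ∀ {A B B′ C D} {f : A ⇒ B} {g : B ⇒ C} {h : C ⇒ D} {g′ : B ⇒ B′} {h′ : B′ ⇒ D} →
            h ∘ g ≈ h′ ∘ g′ → h ∘ (g ∘ f) ≈ h′ ∘ (g′ ∘ f)
  extendʳ p = Equiv.trans (pullˡ p) assoc

  record IsIso {A B : Obj} (f : A ⇒ B) : Set (ℓ ⊔ e) where
    field
      inv  : B ⇒ A
      isoˡ : inv ∘ f ≈ id
      isoʳ : f ∘ inv ≈ id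

_[_,_] : (C : Category o ℓ e) → Category.Obj C → Category.Obj C → Set ℓ
C [ A , B ] = Category._⇒_ C A B

_[_≈_] : (C : Category o ℓ e) {A B : Category.Obj C} → C [ A , B ] → C [ A , B ] → Set e
C [ f ≈ g ] = Category._≈_ C f g

_[_∘_] : (C : Category o ℓ e) {X Y Z : Category.Obj C} →
         C [ Y , Z ] → C [ X , Y ] → C [ X , Z ]
C [ g ∘ f ] = Category._∘_ C g f

_×ᶜ_ : Category o ℓ e → Category o′ ℓ′ e′ → Category (o ⊔ o′) (ℓ ⊔ ℓ′) (e ⊔ e′)
C ×ᶜ D = record
  { Obj       = C.Obj × D.Obj
  ; _⇒_       = λ { (A , B) (A′ , B′) → (A C.⇒ A′) × (B D.⇒ B′) }
  ; _≈_       = λ { (f , g) (f′ , g′) → (f C.≈ f′) × (g D.≈ g′) }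
  ; id        = C.id , D.id
  ; _∘_       = λ { (f , g) (f′ , g′) → (f C.∘ f′) , (g D.∘ g′) }
  ; assoc     = C.assoc , D.assoc
  ; identityˡ = C.identityˡ , D.identityˡ
  ; identityʳ = C.identityʳ , D.identityʳ
  ; equiv     = record
    { refl  = C.Equiv.refl , D.Equiv.refl
    ; sym   = λ { (p , q) → C.Equiv.sym p , D.Equiv.sym q }
    ; trans = λ { (p , q) (p′ , q′) → C.Equiv.trans p p′ , D.Equiv.trans q q′ }
    }
  ; ∘-resp-≈  = λ { (p , q) (p′ , q′) → C.∘-resp-≈ p p′ , D.∘-resp-≈ q q′ }
  }
  where
    module C = Category C
    module D = Category D

record IsFunctor (C : Category o ℓ e) (D : Category o′ ℓ′ e′)
                 (F₀ : Category.Obj C → Category.Obj D)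
                 (F₁ : ∀ {A B} → C [ A , B ] → D [ F₀ A , F₀ B ]) :
                 Set (o ⊔ ℓ ⊔ e ⊔ e′) where
  private
    module C = Category C
    module D = Category D
  field
    identity     : ∀ {A} → F₁ (C.id {A}) D.≈ D.id
    homomorphism : ∀ {X Y Z} {f : X C.⇒ Y} {g : Y C.⇒ Z} →
                   F₁ (g C.∘ f) D.≈ F₁ g D.∘ F₁ f
    F-resp-≈     : ∀ {A B} {f g : A C.⇒ B} → f C.≈ g → F₁ f D.≈ F₁ g

record Functor (C : Category o ℓ e) (D : Category o′ ℓ′ e′) :
               Set (o ⊔ ℓ ⊔ e ⊔ o′ ⊔ ℓ′ ⊔ e′) where
  constructor mkFunctor
  field
    F₀        : Category.Obj C → Category.Obj D
    F₁        : ∀ {A B} → C [ A , B ] → D [ F₀ A , F₀ B ]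
    isFunctor : IsFunctor C D F₀ F₁

  open IsFunctor isFunctor public

_∘F_ : {C : Category o ℓ e} {D : Category o′ ℓ′ e′} {E : Category o″ ℓ″ e″} →
       Functor D E → Functor C D → Functor C E
_∘F_ {E = E} G F = record
  { F₀        = λ A → G.F₀ (F.F₀ A)
  ; F₁        = λ f → G.F₁ (F.F₁ f)
  ; isFunctor = record
    { identity     = E.Equiv.trans (G.F-resp-≈ F.identity) G.identity
    ; homomorphism = E.Equiv.trans (G.F-resp-≈ F.homomorphism) G.homomorphism
    ; F-resp-≈     = λ p → G.F-resp-≈ (F.F-resp-≈ p)
    }
  }
  where
    module E = Category E
    module F = Functor F
    module G = Functor G

record NatTrans {C : Category o ℓ e} {D : Category o′ ℓ′ e′} (F G : Functor C D) :
                Set (o ⊔ ℓ ⊔ ℓ′ ⊔ e′) where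
  private
    module C = Category C
    module D = Category D
    module F = Functor F
    module G = Functor G
  field
    component : ∀ A → F.F₀ A D.⇒ G.F₀ A
    natural   : ∀ {A B} (f : A C.⇒ B) →
                component B D.∘ F.F₁ f D.≈ G.F₁ f D.∘ component A

record MonoidalCategory (o ℓ e : Level) : Set (suc (o ⊔ ℓ ⊔ e)) where
  infixr 10 _⊗_ _⊗₁_
  field
    category : Category o ℓ e

  open Category category public

  field
    tensor : Functor (category ×ᶜ category) category
    unit   : Obj

  _⊗_ : Obj → Obj → Obj
  A ⊗ B = Functor.F₀ tensor (A , B)

  _⊗₁_ : ∀ {A B A′ B′} → A ⇒ A′ → B ⇒ B′ → A ⊗ B ⇒ A′ ⊗ B′
  f ⊗₁ g = Functor.F₁ tensor (f , g)

  field
    unitorˡ    : ∀ A → unit ⊗ A ⇒ A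
    unitorʳ    : ∀ A → A ⊗ unit ⇒ A
    associator : ∀ A B C → (A ⊗ B) ⊗ C ⇒ A ⊗ (B ⊗ C)

    unitorˡ-natural    : ∀ {A B} (f : A ⇒ B) →
                         unitorˡ B ∘ (id ⊗₁ f) ≈ f ∘ unitorˡ A
    unitorʳ-natural    : ∀ {A B} (f : A ⇒ B) →
                         unitorʳ B ∘ (f ⊗₁ id) ≈ f ∘ unitorʳ A
    associator-natural : ∀ {A B C A′ B′ C′} (f : A ⇒ A′) (g : B ⇒ B′) (h : C ⇒ C′) →
                         associator A′ B′ C′ ∘ ((f ⊗₁ g) ⊗₁ h)
                         ≈ (f ⊗₁ (g ⊗₁ h)) ∘ associator A B C

    unitorˡ-iso    : ∀ A → IsIso (unitorˡ A)
    unitorʳ-iso    : ∀ A → IsIso (unitorʳ A)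
    associator-iso : ∀ A B C → IsIso (associator A B C)

    pentagon : ∀ A B C D →
               associator A B (C ⊗ D) ∘ associator (A ⊗ B) C D
               ≈ (id ⊗₁ associator B C D) ∘ (associator A (B ⊗ C) D ∘ (associator A B C ⊗₁ id))
    triangle : ∀ A B → (id ⊗₁ unitorˡ B) ∘ associator A unit B ≈ unitorʳ A ⊗₁ id

-- Chosen finite products, given by a terminal object and binary products.
record FiniteProducts (C : Category o ℓ e) : Set (o ⊔ ℓ ⊔ e) where
  open Category C
  infixr 10 _⊠_
  field
    ⊤        : Obj
    !        : ∀ {A} → A ⇒ ⊤
    !-unique : ∀ {A} (f : A ⇒ ⊤) → f ≈ !

    _⊠_      : Obj → Obj → Obj
    π₁       : ∀ {A B} → A ⊠ B ⇒ A
    π₂       : ∀ {A B} → A ⊠ B ⇒ B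
    ⟨_,_⟩    : ∀ {X A B} → X ⇒ A → X ⇒ B → X ⇒ A ⊠ B
    project₁ : ∀ {X A B} {f : X ⇒ A} {g : X ⇒ B} → π₁ ∘ ⟨ f , g ⟩ ≈ f
    project₂ : ∀ {X A B} {f : X ⇒ A} {g : X ⇒ B} → π₂ ∘ ⟨ f , g ⟩ ≈ g
    ⟨⟩-unique : ∀ {X A B} {f : X ⇒ A} {g : X ⇒ B} (h : X ⇒ A ⊠ B) →
                π₁ ∘ h ≈ f → π₂ ∘ h ≈ g → h ≈ ⟨ f , g ⟩

module _ {V : Category o ℓ e} (P : FiniteProducts V) where
  open Category V
  open FiniteProducts P
  open Equiv using (refl; sym; trans)
  open HomReasoning

  private
    variable
      X A B A′ B′ S T : Obj

    infixr 10 _⊠₁_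

    _⊠₁_ : A ⇒ A′ → B ⇒ B′ → A ⊠ B ⇒ A′ ⊠ B′
    f ⊠₁ g = ⟨ f ∘ π₁ , g ∘ π₂ ⟩

    α : ∀ A B S → (A ⊠ B) ⊠ S ⇒ A ⊠ (B ⊠ S)
    α A B S = ⟨ π₁ ∘ π₁ , ⟨ π₂ ∘ π₁ , π₂ ⟩ ⟩

    α⁻¹ : ∀ A B S → A ⊠ (B ⊠ S) ⇒ (A ⊠ B) ⊠ S
    α⁻¹ A B S = ⟨ ⟨ π₁ , π₁ ∘ π₂ ⟩ , π₂ ∘ π₂ ⟩

    ⟨⟩-cong : {f f′ : X ⇒ A} {g g′ : X ⇒ B} → f ≈ f′ → g ≈ g′ → ⟨ f , g ⟩ ≈ ⟨ f′ , g′ ⟩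
    ⟨⟩-cong p q = ⟨⟩-unique _ (trans project₁ p) (trans project₂ q)

    ⟨⟩-∘ : {f : X ⇒ A} {g : X ⇒ B} {h : S ⇒ X} → ⟨ f , g ⟩ ∘ h ≈ ⟨ f ∘ h , g ∘ h ⟩
    ⟨⟩-∘ = ⟨⟩-unique _ (pullˡ project₁) (pullˡ project₂)

    ⟨⟩-η : {p : X ⇒ A ⊠ B} → p ≈ ⟨ π₁ ∘ p , π₂ ∘ p ⟩
    ⟨⟩-η = ⟨⟩-unique _ refl refl

    ⊠₁-∘ : {f : A ⇒ A′} {g : B ⇒ B′} {x : X ⇒ A} {y : X ⇒ B} →
           (f ⊠₁ g) ∘ ⟨ x , y ⟩ ≈ ⟨ f ∘ x , g ∘ y ⟩
    ⊠₁-∘ = trans ⟨⟩-∘ (⟨⟩-cong (pullʳ project₁) (pullʳ project₂))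

    α-∘ : {x : X ⇒ A} {y : X ⇒ B} {z : X ⇒ S} →
          α A B S ∘ ⟨ ⟨ x , y ⟩ , z ⟩ ≈ ⟨ x , ⟨ y , z ⟩ ⟩
    α-∘ = trans ⟨⟩-∘ (⟨⟩-cong
      (trans (pullʳ project₁) project₁)
      (trans ⟨⟩-∘ (⟨⟩-cong (trans (pullʳ project₁) project₂) project₂)))

    α⁻¹-∘ : {x : X ⇒ A} {y : X ⇒ B} {z : X ⇒ S} →
            α⁻¹ A B S ∘ ⟨ x , ⟨ y , z ⟩ ⟩ ≈ ⟨ ⟨ x , y ⟩ , z ⟩
    α⁻¹-∘ = trans ⟨⟩-∘ (⟨⟩-cong
      (trans ⟨⟩-∘ (⟨⟩-cong project₁ (trans (pullʳ project₂) project₁)))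
      (trans (pullʳ project₂) project₂))

    ext : {f g : A ⊠ B ⇒ T} →
          (∀ {X} (x : X ⇒ A) (y : X ⇒ B) → f ∘ ⟨ x , y ⟩ ≈ g ∘ ⟨ x , y ⟩) → f ≈ g
    ext {f = f} {g} p = begin
      f                          ≈⟨ identityʳ ⟨
      f ∘ id                     ≈⟨ ∘-resp-≈ʳ ⟨⟩-η ⟩
      f ∘ ⟨ π₁ ∘ id , π₂ ∘ id ⟩  ≈⟨ p _ _ ⟩
      g ∘ ⟨ π₁ ∘ id , π₂ ∘ id ⟩  ≈⟨ ∘-resp-≈ʳ ⟨⟩-η ⟨
      g ∘ id                     ≈⟨ identityʳ ⟩
      g                          ∎

    extˡ : {f g : (A ⊠ B) ⊠ S ⇒ T} →
           (∀ {X} (x : X ⇒ A) (y : X ⇒ B) (z : X ⇒ S) →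
              f ∘ ⟨ ⟨ x , y ⟩ , z ⟩ ≈ g ∘ ⟨ ⟨ x , y ⟩ , z ⟩) → f ≈ g
    extˡ p = ext λ xy z →
      trans (∘-resp-≈ʳ (⟨⟩-cong ⟨⟩-η refl))
        (trans (p _ _ z) (∘-resp-≈ʳ (⟨⟩-cong (sym ⟨⟩-η) refl)))

    extʳ : {f g : A ⊠ (B ⊠ S) ⇒ T} →
           (∀ {X} (x : X ⇒ A) (y : X ⇒ B) (z : X ⇒ S) →
              f ∘ ⟨ x , ⟨ y , z ⟩ ⟩ ≈ g ∘ ⟨ x , ⟨ y , z ⟩ ⟩) → f ≈ g
    extʳ p = ext λ x yz →
      trans (∘-resp-≈ʳ (⟨⟩-cong refl ⟨⟩-η))
        (trans (p x _ _) (∘-resp-≈ʳ (⟨⟩-cong refl (sym ⟨⟩-η))))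

    !-∘ : {f g : X ⇒ ⊤} → f ≈ g
    !-∘ = trans (!-unique _) (sym (!-unique _))

    pentagon : ∀ A B S T →
               α A B (S ⊠ T) ∘ α (A ⊠ B) S T
               ≈ (id ⊠₁ α B S T) ∘ (α A (B ⊠ S) T ∘ (α A B S ⊠₁ id))
    pentagon A B S T = extˡ λ xy z w →
      trans (∘-resp-≈ʳ (⟨⟩-cong (⟨⟩-cong ⟨⟩-η refl) refl))
        (trans (trans (lhs _ _ z w) (sym (rhs _ _ z w)))
          (∘-resp-≈ʳ (⟨⟩-cong (⟨⟩-cong (sym ⟨⟩-η) refl) refl)))
      where
        lhs : ∀ {X} (x : X ⇒ A) (y : X ⇒ B) (z : X ⇒ S) (w : X ⇒ T) →
              (α A B (S ⊠ T) ∘ α (A ⊠ B) S T) ∘ ⟨ ⟨ ⟨ x , y ⟩ , z ⟩ , w ⟩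
              ≈ ⟨ x , ⟨ y , ⟨ z , w ⟩ ⟩ ⟩
        lhs x y z w = trans (pullʳ α-∘) α-∘

        rhs : ∀ {X} (x : X ⇒ A) (y : X ⇒ B) (z : X ⇒ S) (w : X ⇒ T) →
              ((id ⊠₁ α B S T) ∘ (α A (B ⊠ S) T ∘ (α A B S ⊠₁ id))) ∘ ⟨ ⟨ ⟨ x , y ⟩ , z ⟩ , w ⟩
              ≈ ⟨ x , ⟨ y , ⟨ z , w ⟩ ⟩ ⟩
        rhs x y z w =
          trans (pullʳ (trans (pullʳ (trans ⊠₁-∘ (⟨⟩-cong α-∘ identityˡ))) α-∘))
            (trans ⊠₁-∘ (⟨⟩-cong identityˡ α-∘))

  cartesian : MonoidalCategory o ℓ e
  cartesian = record
    { category = V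
    ; tensor   = record
      { F₀        = λ { (A , B) → A ⊠ B }
      ; F₁        = λ { (f , g) → f ⊠₁ g }
      ; isFunctor = record
        { identity     = sym (⟨⟩-unique id
                           (trans identityʳ (sym identityˡ)) (trans identityʳ (sym identityˡ)))
        ; homomorphism = sym (trans ⊠₁-∘ (⟨⟩-cong (sym assoc) (sym assoc)))
        ; F-resp-≈     = λ { (p , q) → ⟨⟩-cong (∘-resp-≈ˡ p) (∘-resp-≈ˡ q) }
        }
      }
    ; unit       = ⊤
    ; unitorˡ    = λ _ → π₂
    ; unitorʳ    = λ _ → π₁
    ; associator = α
    ; unitorˡ-natural    = λ _ → project₂
    ; unitorʳ-natural    = λ _ → project₁
    ; associator-natural = λ f g h → extˡ λ x y z → begin
        (α _ _ _ ∘ ((f ⊠₁ g) ⊠₁ h)) ∘ ⟨ ⟨ x , y ⟩ , z ⟩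
          ≈⟨ pullʳ (trans ⊠₁-∘ (⟨⟩-cong ⊠₁-∘ refl)) ⟩
        α _ _ _ ∘ ⟨ ⟨ f ∘ x , g ∘ y ⟩ , h ∘ z ⟩
          ≈⟨ α-∘ ⟩
        ⟨ f ∘ x , ⟨ g ∘ y , h ∘ z ⟩ ⟩
          ≈⟨ trans ⊠₁-∘ (⟨⟩-cong refl ⊠₁-∘) ⟨
        (f ⊠₁ (g ⊠₁ h)) ∘ ⟨ x , ⟨ y , z ⟩ ⟩
          ≈⟨ pullʳ α-∘ ⟨
        ((f ⊠₁ (g ⊠₁ h)) ∘ α _ _ _) ∘ ⟨ ⟨ x , y ⟩ , z ⟩ ∎
    ; unitorˡ-iso = λ _ → record
      { inv  = ⟨ ! , id ⟩
      ; isoˡ = ext λ x y → trans (pullʳ project₂)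
                 (trans ⟨⟩-∘ (trans (⟨⟩-cong !-∘ identityˡ) (sym identityˡ)))
      ; isoʳ = project₂
      }
    ; unitorʳ-iso = λ _ → record
      { inv  = ⟨ id , ! ⟩
      ; isoˡ = ext λ x y → trans (pullʳ project₁)
                 (trans ⟨⟩-∘ (trans (⟨⟩-cong identityˡ !-∘) (sym identityˡ)))
      ; isoʳ = project₁
      }
    ; associator-iso = λ A B S → record
      { inv  = α⁻¹ A B S
      ; isoˡ = extˡ λ _ _ _ → trans (pullʳ α-∘) (trans α⁻¹-∘ (sym identityˡ))
      ; isoʳ = extʳ λ _ _ _ → trans (pullʳ α⁻¹-∘) (trans α-∘ (sym identityˡ))
      }
    ; pentagon = pentagon
    ; triangle = λ A B → extˡ λ x y z →
        trans (pullʳ α-∘) (trans (trans ⊠₁-∘ (⟨⟩-cong refl project₂))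
          (sym (trans ⊠₁-∘ (⟨⟩-cong (trans project₁ (sym identityˡ)) identityˡ))))
    }

-- Naturality of η and μ is stated componentwise, jointly in all variables.
-- The unit law involving the left unitor is derivable, and so is not a field.
record Actegory (M : MonoidalCategory o ℓ e) (o′ ℓ′ e′ : Level) :
                Set (o ⊔ ℓ ⊔ e ⊔ suc (o′ ⊔ ℓ′ ⊔ e′)) where
  infixr 10 _·_ _·₁_
  private
    module M = MonoidalCategory M
  field
    category : Category o′ ℓ′ e′

  open Category category public

  field
    action : Functor (M.category ×ᶜ category) category

  _·_ : M.Obj → Obj → Obj
  m · c = Functor.F₀ action (m , c)

  _·₁_ : ∀ {m n c d} → m M.⇒ n → c ⇒ d → m · c ⇒ n · d
  a ·₁ f = Functor.F₁ action (a , f)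

  field
    η : ∀ c → M.unit · c ⇒ c
    μ : ∀ m n c → (m M.⊗ n) · c ⇒ m · (n · c)

    η-natural : ∀ {c d} (f : c ⇒ d) → η d ∘ (M.id ·₁ f) ≈ f ∘ η c
    μ-natural : ∀ {m m′ n n′ c c′} (a : m M.⇒ m′) (b : n M.⇒ n′) (f : c ⇒ c′) →
                μ m′ n′ c′ ∘ ((a M.⊗₁ b) ·₁ f) ≈ (a ·₁ (b ·₁ f)) ∘ μ m n c

    η-iso : ∀ c → IsIso (η c)
    μ-iso : ∀ m n c → IsIso (μ m n c)

    μ-assoc : ∀ m n p c →
              μ m n (p · c) ∘ μ (m M.⊗ n) p c
              ≈ (M.id ·₁ μ n p c) ∘ (μ m (n M.⊗ p) c ∘ (M.associator m n p ·₁ id))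
    μ-unit  : ∀ m c → (M.id ·₁ η c) ∘ μ m M.unit c ≈ M.unitorʳ m ·₁ id

  ·₁-∘ : ∀ {m n p c d x} {b : n M.⇒ p} {a : m M.⇒ n} {g : d ⇒ x} {f : c ⇒ d} →
         (b ·₁ g) ∘ (a ·₁ f) ≈ (b M.∘ a) ·₁ (g ∘ f)
  ·₁-∘ = Equiv.sym (Functor.homomorphism action)

  ·₁-cong : ∀ {m n c d} {a a′ : m M.⇒ n} {f f′ : c ⇒ d} →
            a M.≈ a′ → f ≈ f′ → a ·₁ f ≈ a′ ·₁ f′
  ·₁-cong p q = Functor.F-resp-≈ action (p , q)

  ·₁-split : ∀ {m c d x} {g : d ⇒ x} {f : c ⇒ d} →
             M.id {m} ·₁ (g ∘ f) ≈ (M.id ·₁ g) ∘ (M.id ·₁ f)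
  ·₁-split = Equiv.trans (·₁-cong (M.Equiv.sym M.identityˡ) Equiv.refl) (Equiv.sym ·₁-∘)

  ·₁-swap : ∀ {m n c d d′ x} {a : m M.⇒ n} {g : d ⇒ x} {f : c ⇒ d} {g′ : d′ ⇒ x} {f′ : c ⇒ d′} →
            g ∘ f ≈ g′ ∘ f′ → (M.id ·₁ g) ∘ (a ·₁ f) ≈ (a ·₁ g′) ∘ (M.id ·₁ f′)
  ·₁-swap p = Equiv.trans ·₁-∘
    (Equiv.trans (·₁-cong (M.Equiv.trans M.identityˡ (M.Equiv.sym M.identityʳ)) p)
      (Equiv.sym ·₁-∘))

self : (M : MonoidalCategory o ℓ e) → Actegory M o ℓ e
self M = record
  { category  = category
  ; action    = tensor
  ; η         = unitorˡ
  ; μ         = associator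
  ; η-natural = unitorˡ-natural
  ; μ-natural = associator-natural
  ; η-iso     = unitorˡ-iso
  ; μ-iso     = associator-iso
  ; μ-assoc   = pentagon
  ; μ-unit    = triangle
  }
  where open MonoidalCategory M

module _ {o ℓ e} {M : MonoidalCategory o ℓ e} where
  private
    module M = MonoidalCategory M

  record LaxEquivariant (C : Actegory M o′ ℓ′ e′) (D : Actegory M o″ ℓ″ e″)
                        (F : Functor (Actegory.category C) (Actegory.category D)) :
                        Set (o ⊔ ℓ ⊔ o′ ⊔ ℓ′ ⊔ ℓ″ ⊔ e″) where
    private
      module C = Actegory C
      module D = Actegory D
    open Functor F
    field
      φ         : ∀ m c → m D.· F₀ c D.⇒ F₀ (m C.· c)
      φ-natural : ∀ {m n c d} (a : m M.⇒ n) (f : c C.⇒ d) →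
                  φ n d D.∘ (a D.·₁ F₁ f) D.≈ F₁ (a C.·₁ f) D.∘ φ m c
      φ-μ       : ∀ m n c →
                  F₁ (C.μ m n c) D.∘ φ (m M.⊗ n) c
                  D.≈ φ m (n C.· c) D.∘ ((M.id D.·₁ φ n c) D.∘ D.μ m n (F₀ c))
      φ-η       : ∀ c → F₁ (C.η c) D.∘ φ M.unit c D.≈ D.η (F₀ c)

  record StrongEquivariant (C : Actegory M o′ ℓ′ e′) (D : Actegory M o″ ℓ″ e″)
                           (F : Functor (Actegory.category C) (Actegory.category D)) :
                           Set (o ⊔ ℓ ⊔ o′ ⊔ ℓ′ ⊔ ℓ″ ⊔ e″) where
    field
      lax   : LaxEquivariant C D F
    open LaxEquivariant lax public
    field
      φ-iso : ∀ m c → Actegory.IsIso D (φ m c)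

  Equivariant : {C : Actegory M o′ ℓ′ e′} {D : Actegory M o″ ℓ″ e″}
                {F G : Functor (Actegory.category C) (Actegory.category D)} →
                LaxEquivariant C D F → LaxEquivariant C D G → NatTrans F G → Set _
  Equivariant {C = C} {D} φF φG θ =
    ∀ m c → component (m C.· c) D.∘ φF.φ m c D.≈ φG.φ m c D.∘ (M.id D.·₁ component c)
    where
      module C = Actegory C
      module D = Actegory D
      module φF = LaxEquivariant φF
      module φG = LaxEquivariant φG
      open NatTrans θ

  _∘L_ : ∀ {o₁ ℓ₁ e₁} {B : Actegory M o₁ ℓ₁ e₁}
         {C : Actegory M o′ ℓ′ e′} {D : Actegory M o″ ℓ″ e″}
         {H : Functor (Actegory.category C) (Actegory.category D)}
         {F : Functor (Actegory.category B) (Actegory.category C)} →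
         LaxEquivariant C D H → LaxEquivariant B C F → LaxEquivariant B D (H ∘F F)
  _∘L_ {B = B} {C} {D} {H} {F} φH φF = record
    { φ         = φ
    ; φ-natural = λ a f → begin
        φ _ _ D.∘ (a D.·₁ H.F₁ (F.F₁ f))
          ≈⟨ D.pullʳ (φH.φ-natural a (F.F₁ f)) ⟩
        H.F₁ (φF.φ _ _) D.∘ (H.F₁ (a C.·₁ F.F₁ f) D.∘ φH.φ _ _)
          ≈⟨ D.extendʳ (H-square (φF.φ-natural a f)) ⟩
        H.F₁ (F.F₁ (a B.·₁ f)) D.∘ φ _ _ ∎
    ; φ-μ       = λ m n c → begin
        H.F₁ (F.F₁ (B.μ m n c)) D.∘ (H.F₁ (φF.φ (m M.⊗ n) c) D.∘ φH.φ (m M.⊗ n) (F.F₀ c))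
          ≈⟨ D.extendʳ (H-square (φF.φ-μ m n c)) ⟩
        H.F₁ (φF.φ m (n B.· c)) D.∘
          (H.F₁ ((M.id C.·₁ φF.φ n c) C.∘ C.μ m n (F.F₀ c)) D.∘ φH.φ (m M.⊗ n) (F.F₀ c))
          ≈⟨ D.∘-resp-≈ʳ (D.∘-resp-≈ˡ H.homomorphism) ⟩
        H.F₁ (φF.φ m (n B.· c)) D.∘
          ((H.F₁ (M.id C.·₁ φF.φ n c) D.∘ H.F₁ (C.μ m n (F.F₀ c))) D.∘ φH.φ (m M.⊗ n) (F.F₀ c))
          ≈⟨ D.∘-resp-≈ʳ (D.pullʳ (φH.φ-μ m n (F.F₀ c))) ⟩
        H.F₁ (φF.φ m (n B.· c)) D.∘
          (H.F₁ (M.id C.·₁ φF.φ n c) D.∘ (φH.φ m (n C.· F.F₀ c) D.∘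
            ((M.id D.·₁ φH.φ n (F.F₀ c)) D.∘ D.μ m n (H.F₀ (F.F₀ c)))))
          ≈⟨ D.∘-resp-≈ʳ (D.extendʳ (D.Equiv.sym (φH.φ-natural M.id (φF.φ n c)))) ⟩
        H.F₁ (φF.φ m (n B.· c)) D.∘ (φH.φ m (F.F₀ (n B.· c)) D.∘
          ((M.id D.·₁ H.F₁ (φF.φ n c)) D.∘
            ((M.id D.·₁ φH.φ n (F.F₀ c)) D.∘ D.μ m n (H.F₀ (F.F₀ c)))))
          ≈⟨ D.∘-resp-≈ʳ (D.∘-resp-≈ʳ (D.pullˡ (D.Equiv.sym D.·₁-split))) ⟩
        H.F₁ (φF.φ m (n B.· c)) D.∘ (φH.φ m (F.F₀ (n B.· c)) D.∘
          ((M.id D.·₁ φ n c) D.∘ D.μ m n (H.F₀ (F.F₀ c))))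
          ≈⟨ D.assoc ⟨
        φ m (n B.· c) D.∘ ((M.id D.·₁ φ n c) D.∘ D.μ m n (H.F₀ (F.F₀ c))) ∎
    ; φ-η       = λ c → begin
        H.F₁ (F.F₁ (B.η c)) D.∘ φ M.unit c
          ≈⟨ D.pullˡ (D.Equiv.trans (D.Equiv.sym H.homomorphism) (H.F-resp-≈ (φF.φ-η c))) ⟩
        H.F₁ (C.η (F.F₀ c)) D.∘ φH.φ M.unit (F.F₀ c)
          ≈⟨ φH.φ-η (F.F₀ c) ⟩
        D.η (H.F₀ (F.F₀ c)) ∎
    }
    where
      module B = Actegory B
      module C = Actegory C
      module D = Actegory D
      module H = Functor H
      module F = Functor F
      module φH = LaxEquivariant φH
      module φF = LaxEquivariant φF
      open D.HomReasoning

      φ : ∀ m c → m D.· H.F₀ (F.F₀ c) D.⇒ H.F₀ (F.F₀ (m B.· c))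
      φ m c = H.F₁ (φF.φ m c) D.∘ φH.φ m (F.F₀ c)

      H-square : ∀ {w x y z} {g : x C.⇒ z} {f : w C.⇒ x} {g′ : y C.⇒ z} {f′ : w C.⇒ y} →
                 g C.∘ f C.≈ g′ C.∘ f′ → H.F₁ g D.∘ H.F₁ f D.≈ H.F₁ g′ D.∘ H.F₁ f′
      H-square p = D.Equiv.trans (D.Equiv.sym H.homomorphism)
        (D.Equiv.trans (H.F-resp-≈ p) H.homomorphism)

record Model {V : Category o ℓ e} (P : FiniteProducts V)
             (C : Actegory (cartesian P) o′ ℓ′ e′) :
             Set (o ⊔ ℓ ⊔ e ⊔ o′ ⊔ ℓ′ ⊔ e′) where
  field
    functor : Functor V (Actegory.category C)
    strong  : StrongEquivariant (self (cartesian P)) C functor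

  open Functor functor public
  open StrongEquivariant strong public

record ModelMorphism {V : Category o ℓ e} {P : FiniteProducts V}
                     {C : Actegory (cartesian P) o′ ℓ′ e′}
                     {D : Actegory (cartesian P) o″ ℓ″ e″}
                     (F : Model P C) (F′ : Model P D) :
                     Set (o ⊔ ℓ ⊔ e ⊔ o′ ⊔ ℓ′ ⊔ e′ ⊔ o″ ⊔ ℓ″ ⊔ e″) where
  field
    H             : Functor (Actegory.category C) (Actegory.category D)
    H-lax         : LaxEquivariant C D H
    θ             : NatTrans (Model.functor F′) (H ∘F Model.functor F)
    θ-equivariant : Equivariant (Model.lax F′) (H-lax ∘L Model.lax F) θ

module _ {C : Category o ℓ e} {D : Category o′ ℓ′ e′} (H : Functor C D) where
  private
    module C = Category C
    module D = Category D
  open Functor H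

  record GluingObj : Set (o ⊔ o′ ⊔ ℓ′) where
    constructor glue
    field
      {dom} : D.Obj
      {cod} : C.Obj
      arr   : dom D.⇒ F₀ cod

  record GluingHom (X Y : GluingObj) : Set (ℓ ⊔ ℓ′ ⊔ e′) where
    constructor glueHom
    private
      module X = GluingObj X
      module Y = GluingObj Y
    field
      top    : X.dom D.⇒ Y.dom
      bot    : X.cod C.⇒ Y.cod
      square : Y.arr D.∘ top D.≈ F₁ bot D.∘ X.arr

  open GluingObj
  open GluingHom

  Gluing : Category (o ⊔ o′ ⊔ ℓ′) (ℓ ⊔ ℓ′ ⊔ e′) (e ⊔ e′)
  Gluing = record
    { Obj       = GluingObj
    ; _⇒_       = GluingHom
    ; _≈_       = λ f g → (top f D.≈ top g) × (bot f C.≈ bot g)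
    ; id        = glueHom D.id C.id
                    (D.Equiv.trans D.identityʳ
                      (D.Equiv.sym (D.Equiv.trans (D.∘-resp-≈ˡ identity) D.identityˡ)))
    ; _∘_       = λ g f → glueHom (top g D.∘ top f) (bot g C.∘ bot f)
                    (D.Equiv.trans (D.pullˡ (square g))
                      (D.Equiv.trans (D.pullʳ (square f)) (D.pullˡ (D.Equiv.sym homomorphism))))
    ; assoc     = D.assoc , C.assoc
    ; identityˡ = D.identityˡ , C.identityˡ
    ; identityʳ = D.identityʳ , C.identityʳ
    ; equiv     = record
      { refl  = D.Equiv.refl , C.Equiv.refl
      ; sym   = λ { (p , q) → D.Equiv.sym p , C.Equiv.sym q }
      ; trans = λ { (p , q) (p′ , q′) → D.Equiv.trans p p′ , C.Equiv.trans q q′ }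
      }
    ; ∘-resp-≈  = λ { (p , q) (p′ , q′) → D.∘-resp-≈ p p′ , C.∘-resp-≈ q q′ }
    }

  gluing-iso : ∀ {X Y} (f : GluingHom X Y) →
               D.IsIso (top f) → C.IsIso (bot f) → Category.IsIso Gluing f
  gluing-iso {X} {Y} f i j = record
    { inv  = glueHom i.inv j.inv inv-square
    ; isoˡ = i.isoˡ , j.isoˡ
    ; isoʳ = i.isoʳ , j.isoʳ
    }
    where
      module i = D.IsIso i
      module j = C.IsIso j
      open D.HomReasoning

      inv-square : arr X D.∘ i.inv D.≈ F₁ j.inv D.∘ arr Y
      inv-square = begin
        arr X D.∘ i.inv
          ≈⟨ D.identityˡ ⟨
        D.id D.∘ (arr X D.∘ i.inv)
          ≈⟨ D.∘-resp-≈ˡ (D.Equiv.trans (F-resp-≈ j.isoˡ) identity) ⟨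
        F₁ (j.inv C.∘ bot f) D.∘ (arr X D.∘ i.inv)
          ≈⟨ D.∘-resp-≈ˡ homomorphism ⟩
        (F₁ j.inv D.∘ F₁ (bot f)) D.∘ (arr X D.∘ i.inv)
          ≈⟨ D.pullʳ (D.extendʳ (D.Equiv.sym (square f))) ⟩
        F₁ j.inv D.∘ (arr Y D.∘ (top f D.∘ i.inv))
          ≈⟨ D.∘-resp-≈ʳ (D.Equiv.trans (D.∘-resp-≈ʳ i.isoʳ) D.identityʳ) ⟩
        F₁ j.inv D.∘ arr Y ∎

module _ {M : MonoidalCategory o ℓ e}
         {C : Actegory M o′ ℓ′ e′} {D : Actegory M o″ ℓ″ e″}
         {H : Functor (Actegory.category C) (Actegory.category D)}
         (H-lax : LaxEquivariant C D H) where
  private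
    module M = MonoidalCategory M
    module C = Actegory C
    module D = Actegory D
    module H = Functor H
  open LaxEquivariant H-lax
  open GluingObj
  open GluingHom
  open D.HomReasoning

  private
    infixr 10 _∙_ _∙₁_

    _∙_ : M.Obj → GluingObj H → GluingObj H
    m ∙ X = glue (φ m (cod X) D.∘ (M.id D.·₁ arr X))

    _∙₁_ : ∀ {m n X Y} → m M.⇒ n → GluingHom H X Y → GluingHom H (m ∙ X) (n ∙ Y)
    _∙₁_ {m} {n} {X} {Y} a f = glueHom (a D.·₁ top f) (a C.·₁ bot f) (begin
      (φ n (cod Y) D.∘ (M.id D.·₁ arr Y)) D.∘ (a D.·₁ top f)
        ≈⟨ D.pullʳ (D.·₁-swap (square f)) ⟩
      φ n (cod Y) D.∘ ((a D.·₁ H.F₁ (bot f)) D.∘ (M.id D.·₁ arr X))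
        ≈⟨ D.extendʳ (φ-natural a (bot f)) ⟩
      H.F₁ (a C.·₁ bot f) D.∘ (φ m (cod X) D.∘ (M.id D.·₁ arr X)) ∎)

    ηᴳ : ∀ X → GluingHom H (M.unit ∙ X) X
    ηᴳ X = glueHom (D.η (dom X)) (C.η (cod X)) (begin
      arr X D.∘ D.η (dom X)
        ≈⟨ D.η-natural (arr X) ⟨
      D.η (H.F₀ (cod X)) D.∘ (M.id D.·₁ arr X)
        ≈⟨ D.pullˡ (φ-η (cod X)) ⟨
      H.F₁ (C.η (cod X)) D.∘ (φ M.unit (cod X) D.∘ (M.id D.·₁ arr X)) ∎)

    μᴳ : ∀ m n X → GluingHom H ((m M.⊗ n) ∙ X) (m ∙ (n ∙ X))
    μᴳ m n X = glueHom (D.μ m n (dom X)) (C.μ m n (cod X)) (D.Equiv.sym (begin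
      H.F₁ (C.μ m n (cod X)) D.∘ (φ (m M.⊗ n) (cod X) D.∘ (M.id D.·₁ arr X))
        ≈⟨ D.pullˡ (φ-μ m n (cod X)) ⟩
      (φ m (n C.· cod X) D.∘ ((M.id D.·₁ φ n (cod X)) D.∘ D.μ m n (H.F₀ (cod X))))
        D.∘ (M.id D.·₁ arr X)
        ≈⟨ D.pullʳ (D.pullʳ (D.Equiv.trans
             (D.∘-resp-≈ʳ (D.·₁-cong (M.Equiv.sym (Functor.identity M.tensor)) D.Equiv.refl))
             (D.μ-natural M.id M.id (arr X)))) ⟩
      φ m (n C.· cod X) D.∘
        ((M.id D.·₁ φ n (cod X)) D.∘ ((M.id D.·₁ (M.id D.·₁ arr X)) D.∘ D.μ m n (dom X)))
        ≈⟨ D.∘-resp-≈ʳ (D.pullˡ (D.Equiv.sym D.·₁-split)) ⟩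
      φ m (n C.· cod X) D.∘
        ((M.id D.·₁ (φ n (cod X) D.∘ (M.id D.·₁ arr X))) D.∘ D.μ m n (dom X))
        ≈⟨ D.assoc ⟨
      (φ m (n C.· cod X) D.∘ (M.id D.·₁ (φ n (cod X) D.∘ (M.id D.·₁ arr X))))
        D.∘ D.μ m n (dom X) ∎))

  gluingActegory : Actegory M (o′ ⊔ o″ ⊔ ℓ″) (ℓ′ ⊔ ℓ″ ⊔ e″) (e′ ⊔ e″)
  gluingActegory = record
    { category  = Gluing H
    ; action    = record
      { F₀        = λ { (m , X) → m ∙ X }
      ; F₁        = λ { (a , f) → a ∙₁ f }
      ; isFunctor = record
        { identity     = Functor.identity D.action , Functor.identity C.action
        ; homomorphism = Functor.homomorphism D.action , Functor.homomorphism C.action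
        ; F-resp-≈     = λ { (p , q , r) → D.·₁-cong p q , C.·₁-cong p r }
        }
      }
    ; η         = ηᴳ
    ; μ         = μᴳ
    ; η-natural = λ f → D.η-natural (top f) , C.η-natural (bot f)
    ; μ-natural = λ a b f → D.μ-natural a b (top f) , C.μ-natural a b (bot f)
    ; η-iso     = λ X → gluing-iso H (ηᴳ X) (D.η-iso (dom X)) (C.η-iso (cod X))
    ; μ-iso     = λ m n X →
        gluing-iso H (μᴳ m n X) (D.μ-iso m n (dom X)) (C.μ-iso m n (cod X))
    ; μ-assoc   = λ m n p X → D.μ-assoc m n p (dom X) , C.μ-assoc m n p (cod X)
    ; μ-unit    = λ m X → D.μ-unit m (dom X) , C.μ-unit m (cod X)
    }

{-# OPTIONS --safe #-}
module Submission where

open import Level using (Level)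
open import Data.Product using (Σ-syntax; _,_)
open import Defs

-- Composition, action, `η` and `μ` of the gluing category are componentwise, so each law for `L` is
-- the law for `F′` paired with the law for `F`. What remains is that the pairs are morphisms of the
-- gluing category: naturality of `θ` gives the square for `L a`, and equivariance of `θ` the square
-- for the structure map.

proposition25 :
  ∀ {o ℓ e oC ℓC eC oD ℓD eD : Level} {V : Category o ℓ e} (P : FiniteProducts V)
    {C : Actegory (cartesian P) oC ℓC eC} {D : Actegory (cartesian P) oD ℓD eD}
    (F : Model P C) (F′ : Model P D) (K : ModelMorphism F F′) →
  let module D = Actegory D
      module F = Model F
      module F′ = Model F′
      open ModelMorphism K
      module H = Functor H
      open NatTrans θ renaming (component to θ[_])
      L₀ : Category.Obj V → GluingObj H
      L₀ = λ v → glue {dom = F′.F₀ v} {cod = F.F₀ v} θ[ v ]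
  in
  Σ[ square ∈ (∀ {v u} (a : V [ v , u ]) → θ[ u ] D.∘ F′.F₁ a D.≈ H.F₁ (F.F₁ a) D.∘ θ[ v ]) ]
  Σ[ isFunctor ∈ IsFunctor V (Gluing H) L₀ (λ a → glueHom (F′.F₁ a) (F.F₁ a) (square a)) ]
  StrongEquivariant (self (cartesian P)) (gluingActegory H-lax) (mkFunctor L₀ (λ a → glueHom (F′.F₁ a) (F.F₁ a) (square a)) isFunctor)
proposition25 P {C} {D} F F′ K = natural , isFunctor , record
  { lax   = record
    { φ         = φ
    -- Equality of gluing morphisms compares `top` and `bot` only, so no coherence between squares
    -- has to be checked.
    ; φ-natural = λ a f → F′.φ-natural a f , F.φ-natural a f
    ; φ-μ       = λ m n c → F′.φ-μ m n c , F.φ-μ m n c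
    ; φ-η       = λ c → F′.φ-η c , F.φ-η c
    }
  -- Inverting both sides of a commuting square leaves it commuting, so invertible components
  -- suffice.
  ; φ-iso = λ m c → gluing-iso H (φ m c) (F′.φ-iso m c) (F.φ-iso m c)
  }
  where
    module D = Actegory D
    module F = Model F
    module F′ = Model F′
    open ModelMorphism K
    open NatTrans θ

    isFunctor : IsFunctor _ (Gluing H) (λ v → glue (component v))
                  (λ a → glueHom (F′.F₁ a) (F.F₁ a) (natural a))
    isFunctor = record
      { identity     = F′.identity , F.identity
      ; homomorphism = F′.homomorphism , F.homomorphism
      ; F-resp-≈     = λ p → F′.F-resp-≈ p , F.F-resp-≈ p
      }

    -- The square expressing that (φ^F′ , φ^F) is a morphism of D ↓ H is the
    -- equivariance of θ, up to associativity.
    φ : ∀ m c → GluingHom H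
          (Actegory._·_ (gluingActegory H-lax) m (glue (component c)))
          (glue (component (Actegory._·_ (self (cartesian P)) m c)))
    φ m c = glueHom (F′.φ m c) (F.φ m c) (D.Equiv.trans (θ-equivariant m c) D.assoc)
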